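{- Let $N=\{1,\dots,n\}$ and let $1\le \alpha\le k\le n$ be integers. Any non-adaptive algorithm (fixed sequence of queries $Q_1,\dots,Q_t\subseteq N$) solving Group Testing for hidden sets of size at most $k$ needs: (i) $\Omega\left(\min\left\{\left(\frac{k}{\alpha}\right)^2, \frac{n}{\alpha} \right\} + k\,\frac{\log\frac{n}{k}}{\log \alpha}\right)$ queries under the feedback $F_{\alpha}(X)=\min\{|X|,\alpha\}$; (ii) $\Omega\left(\min\left\{\left(\frac{k}{\alpha}\right)^2, \frac{n}{\alpha} \right\}\right)$ queries under any feedback function capped at $\alpha$.
   Context: Let $N=\{1,\dots,n\}$. A feedback function is a deterministic function $F$ defined on subsets of $N$. It is capped at $\alpha$ if it outputs one and the same (arbitrary fixed) value on all subsets of $N$ with more than $\alpha$ elements; on sets with at most $\alpha$ elements it may be arbitrary (for instance it may return the set itself). A fixed sequence of queries $Q_1,\dots,Q_t\subseteq N$ solves Group Testing (for parameter $k$) under feedback $F$ if for any two different sets $K_1,K_2\subseteq N$ with $|K_1|,|K_2|\le k$ the feedback vectors $\langle F(Q_1\cap K_1),\dots,F(Q_t\cap K_1)\rangle$ and $\langle F(Q_1\cap K_2),\dots,F(Q_t\cap K_2)\rangle$ are different. No computational restrictions on constructing the queries or on decoding are imposed.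
   Formalization: For α = 1 the expression k·log(n/k)/log α in (i) divides by log 1 = 0 and is undefined; the formal statement reads log α as log max{α, 2}, which is unchanged for α ≥ 2. -}

module Defs where

open import Data.Fin.Subset using (Subset; _∩_; ∣_∣)
open import Data.Integer using (+_; -[1+_])
open import Data.Nat as ℕ using (ℕ; suc; NonZero)
open import Data.Product using (∃-syntax; _×_)
open import Data.Rational using (ℚ; _+_; _*_; _⊓_; _≤_; _/_; 1ℚ; ↥_; ↧ₙ_; +-*-rawSemiring)
open import Data.Vec using (Vec; map)
open import Relation.Binary.PropositionalEquality using (_≡_; _≢_)

open import Algebra.Definitions.RawSemiring +-*-rawSemiring public using (_^_)

Feedback : ℕ → Set → Set
Feedback n A = Subset n → A

F[_] : ∀ {n} → ℕ → Feedback n ℕ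
F[ α ] X = ∣ X ∣ ℕ.⊓ α

CappedAt : ∀ {n A} → ℕ → Feedback n A → Set
CappedAt α F = ∃[ v ] (∀ X → α ℕ.< ∣ X ∣ → F X ≡ v)

feedbackVector : ∀ {n t A} → Feedback n A → Vec (Subset n) t → Subset n → Vec A t
feedbackVector F Qs K = map (λ Q → F (Q ∩ K)) Qs

SolvesGroupTesting : ∀ {n t A} → ℕ → Feedback n A → Vec (Subset n) t → Set
SolvesGroupTesting k F Qs =
  ∀ K₁ K₂ → ∣ K₁ ∣ ℕ.≤ k → ∣ K₂ ∣ ℕ.≤ k → K₁ ≢ K₂ →
  feedbackVector F Qs K₁ ≢ feedbackVector F Qs K₂

-- A real number x is represented by the lower cut { r ∈ ℚ ∣ r ≤ x }.
LowerReal : Set₁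
LowerReal = ℚ → Set

↑_ : ℚ → LowerReal
(↑ q) r = r ≤ q

infixl 6 _⊕_
_⊕_ : LowerReal → LowerReal → LowerReal
(x ⊕ y) r = ∃[ a ] ∃[ b ] (x a × y b × r ≤ a + b)

-- Multiplication by a rational; meaningful only for q ≥ 0.
infixr 7 _⊛_
_⊛_ : ℚ → LowerReal → LowerReal
(q ⊛ x) r = ∃[ a ] (x a × r ≤ q * a)

-- Cuts are compared only with rationals, so it does not matter whether x
-- contains its supremum.
infix 4 _≤ℚ_
_≤ℚ_ : LowerReal → ℚ → Set
x ≤ℚ q = ∀ r → x r → r ≤ q

-- log x / log b for x > 0 and b > 1 (any base of the logarithm): for r = p / d
-- with d > 0, r ≤ log x / log b iff p · log b ≤ d · log x iff bᵖ ≤ xᵈ.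
log_/log_ : ℚ → ℚ → LowerReal
(log x /log b) r with ↥ r
... | + p      = b ^ p ≤ x ^ (↧ₙ r)
... | -[1+ p ] = 1ℚ ≤ b ^ (suc p) * x ^ (↧ₙ r)

-- min { (k/α)² , n/α }
minTerm : (n k α : ℕ) → .{{NonZero α}} → ℚ
minTerm n k α = (+ k / α) ^ 2 ⊓ (+ n / α)

-- k · log(n/k) / log α.  For α = 1 the denominator log α would vanish; there it
-- is read as log 2, and for α ≥ 2 it is exactly log α.
logTerm : (n k α : ℕ) → .{{NonZero k}} → LowerReal
logTerm n k α = (+ k / 1) ⊛ (log (+ n / k) /log (+ (α ℕ.⊔ 2) / 1))

{-# OPTIONS --safe #-}

-- (ii) Put a = α + 1 and let d ≥ 1.  Starting from ∅, keep adding to K an element lying in at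
-- least d queries that meet K in fewer than a elements.  Each step lowers the total deficit
-- Σ_Q (a ∸ ∣Q ∩ K∣) ≤ t a by at least d, so at most t a / d elements are added.  If n > 2 t a,
-- some x ∉ K lies in no query of size ≤ a; at most d − 1 queries through x still have fewer than
-- a elements in K, and (d − 1) a further elements other than x saturate them.  The enlarged K and
-- K ∪ {x} then receive equal feedback, so t a / d + (d − 1) a ≥ k.  With d ≈ k / 2a this gives
-- t = Ω((k / α)²).
--
-- (i) A function f : Fin k → Fin n is determined by its image S, of size ≤ k, together with the
-- ranks of the f i in S.  The feedback vector determines S, so nᵏ ≤ (α + 1)ᵗ kᵏ;
-- moreover α + 1 ≤ (α ⊔ 2)².
module Submission where

module Combinatorics where

  open import Data.Bool using (if_then_else_)
  open import Data.Bool.Properties using () renaming (_≟_ to _≟ᵇ_)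
  open import Data.Fin using (Fin; zero; suc; fromℕ<; combine; funToFin; finToFun)
  open import Data.Fin.Properties using (any?; fromℕ<-injective; combine-injective; funToFin-finToFin; finToFun-funToFin; injective⇒≤) renaming (_≟_ to _≟ᶠ_)
  open import Data.Fin.Subset using (Subset; inside; outside; _∩_; _∪_; ∣_∣; ∁; ⁅_⁆; _∈_; _∉_) renaming (⊤ to full; ⊥ to ∅)
  open import Data.Fin.Subset.Properties using (_∈?_; ∩-identityˡ; ∈⊤; ∣⊥∣≡0; p⊆q⇒∣p∣≤∣q∣; x∈⁅x⁆; x≢y⇒x∉⁅y⁆; x∉p⇒x∈∁p; x∈p⇒x∉∁p; x∈p∩q⁺; x∈p∪q⁺; ∣⁅x⁆∣≡1)
  open import Data.Nat
  open import Data.Nat.DivMod using (m/n*n≤m; m%n<n; m≡m%n+[m/n]*n)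
  open import Data.Nat.Induction using (<-wellFounded)
  open import Data.Nat.Properties hiding (_≟_)
  open import Data.Nat.Tactic.RingSolver using (solve-∀)
  open import Data.Product using (∃-syntax; _×_; _,_)
  open import Data.Sum using (_⊎_; inj₁; inj₂; [_,_]′)
  open import Data.Vec using (Vec; []; _∷_; map; sum; lookup; _[_]≔_; here; there)
  open import Data.Vec.Membership.Propositional using () renaming (_∈_ to _∈ᵥ_)
  open import Data.Vec.Properties using (≡-dec; lookup-map; tabulate∘lookup; tabulate-cong)
  import Data.Vec.Relation.Unary.Any as Any
  open import Defs hiding (_^_)
  open import Function using (_∘_; const)
  open import Induction.WellFounded using (Acc; acc)
  open import Relation.Binary.PropositionalEquality
  open import Relation.Nullary using (yes; no; does; contradiction; ¬?)
  open import Relation.Nullary.Decidable using (_×-dec_; decidable-stable; dec-true)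

  private variable
    n t : ℕ

  -- Subsets enlarged by one element, and elements avoiding all small queries.

  _∪[_] : Subset n → Fin n → Subset n
  K ∪[ x ] = K [ x ]≔ inside

  ∣Q∩K∪[x]∣ : ∀ {x} {Q K : Subset n} → x ∈ Q → x ∉ K → ∣ Q ∩ (K ∪[ x ]) ∣ ≡ suc ∣ Q ∩ K ∣
  ∣Q∩K∪[x]∣ {K = inside ∷ K} here x∉K = contradiction here x∉K
  ∣Q∩K∪[x]∣ {K = outside ∷ K} here x∉K = refl
  ∣Q∩K∪[x]∣ {Q = inside ∷ Q} {K = inside ∷ K} (there x∈Q) x∉K = cong suc (∣Q∩K∪[x]∣ x∈Q (x∉K ∘ there))
  ∣Q∩K∪[x]∣ {Q = inside ∷ Q} {K = outside ∷ K} (there x∈Q) x∉K = ∣Q∩K∪[x]∣ x∈Q (x∉K ∘ there)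
  ∣Q∩K∪[x]∣ {Q = outside ∷ Q} {K = _ ∷ K} (there x∈Q) x∉K = ∣Q∩K∪[x]∣ x∈Q (x∉K ∘ there)

  Q∩K∪[x]≡Q∩K : ∀ {x} {Q : Subset n} (K : Subset n) → x ∉ Q → Q ∩ (K ∪[ x ]) ≡ Q ∩ K
  Q∩K∪[x]≡Q∩K {x = zero} {inside ∷ Q} _ x∉Q = contradiction here x∉Q
  Q∩K∪[x]≡Q∩K {x = zero} {outside ∷ Q} (_ ∷ K) x∉Q = refl
  Q∩K∪[x]≡Q∩K {x = suc x} {_ ∷ Q} (_ ∷ K) x∉Q = cong (_ ∷_) (Q∩K∪[x]≡Q∩K K (x∉Q ∘ there))

  ∣K∪[x]∣ : ∀ {x} {K : Subset n} → x ∉ K → ∣ K ∪[ x ] ∣ ≡ suc ∣ K ∣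
  ∣K∪[x]∣ {x = x} {K} x∉K = begin
    ∣ K ∪[ x ] ∣           ≡⟨ cong ∣_∣ (∩-identityˡ (K ∪[ x ])) ⟨
    ∣ full ∩ (K ∪[ x ]) ∣  ≡⟨ ∣Q∩K∪[x]∣ ∈⊤ x∉K ⟩
    suc ∣ full ∩ K ∣       ≡⟨ cong (suc ∘ ∣_∣) (∩-identityˡ K) ⟩
    suc ∣ K ∣              ∎
    where open ≡-Reasoning

  ∈-∪[]⁻ : ∀ {x y} (K : Subset n) → y ∈ K ∪[ x ] → y ≡ x ⊎ y ∈ K
  ∈-∪[]⁻ {x = zero}  {zero}  (_ ∷ K) _ = inj₁ refl
  ∈-∪[]⁻ {x = zero}  {suc y} (_ ∷ K) (there y∈) = inj₂ (there y∈)
  ∈-∪[]⁻ {x = suc x} {zero}  (_ ∷ K) here = inj₂ here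
  ∈-∪[]⁻ {x = suc x} {suc y} (_ ∷ K) (there y∈) with ∈-∪[]⁻ K y∈
  ... | inj₁ refl = inj₁ refl
  ... | inj₂ y∈K = inj₂ (there y∈K)

  x∈K∪[x] : ∀ x (K : Subset n) → x ∈ K ∪[ x ]
  x∈K∪[x] zero    (_ ∷ K) = here
  x∈K∪[x] (suc x) (_ ∷ K) = there (x∈K∪[x] x K)

  ∣p∪q∣≤∣p∣+∣q∣ : (p q : Subset n) → ∣ p ∪ q ∣ ≤ ∣ p ∣ + ∣ q ∣
  ∣p∪q∣≤∣p∣+∣q∣ [] [] = z≤n
  ∣p∪q∣≤∣p∣+∣q∣ (outside ∷ p) (outside ∷ q) = ∣p∪q∣≤∣p∣+∣q∣ p q
  ∣p∪q∣≤∣p∣+∣q∣ (outside ∷ p) (inside ∷ q) =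
    ≤-trans (s≤s (∣p∪q∣≤∣p∣+∣q∣ p q)) (≤-reflexive (sym (+-suc ∣ p ∣ ∣ q ∣)))
  ∣p∪q∣≤∣p∣+∣q∣ (inside ∷ p) (outside ∷ q) = s≤s (∣p∪q∣≤∣p∣+∣q∣ p q)
  ∣p∪q∣≤∣p∣+∣q∣ (inside ∷ p) (inside ∷ q) =
    s≤s (≤-trans (∣p∪q∣≤∣p∣+∣q∣ p q) (+-monoʳ-≤ ∣ p ∣ (n≤1+n ∣ q ∣)))

  ∃∉ : (K : Subset n) → ∣ K ∣ < n → ∃[ x ] x ∉ K
  ∃∉ (outside ∷ K) _ = zero , λ ()
  ∃∉ (inside ∷ K) (s≤s ∣K∣<n) with ∃∉ K ∣K∣<n
  ... | x , x∉K = suc x , λ where (there x∈K) → x∉K x∈K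

  -- Induction over the queries: each one of size at most `a` is absorbed into `K`, using up its
  -- share `a` of the budget `t * a`. The final union still has fewer than `n` elements, so
  -- something lies outside it.
  uncovered : ∀ a (Qs : Vec (Subset n) t) (K : Subset n) → ∣ K ∣ + t * a < n →
              ∃[ x ] (x ∉ K × (∀ {Q} → Q ∈ᵥ Qs → x ∈ Q → a < ∣ Q ∣))
  uncovered a [] K bound with ∃∉ K (subst (_< _) (+-identityʳ ∣ K ∣) bound)
  ... | x , x∉K = x , x∉K , λ ()
  uncovered {t = suc t} a (Q ∷ Qs) K bound with a <? ∣ Q ∣
  ... | no a≮∣Q∣ with uncovered a Qs (K ∪ Q) (≤-<-trans ∣K∪Q∣+ta≤ bound)
    where
    open ≤-Reasoning
    ∣K∪Q∣+ta≤ : ∣ K ∪ Q ∣ + t * a ≤ ∣ K ∣ + (a + t * a)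
    ∣K∪Q∣+ta≤ = begin
      ∣ K ∪ Q ∣ + t * a      ≤⟨ +-monoˡ-≤ (t * a) (∣p∪q∣≤∣p∣+∣q∣ K Q) ⟩
      ∣ K ∣ + ∣ Q ∣ + t * a  ≤⟨ +-monoˡ-≤ (t * a) (+-monoʳ-≤ ∣ K ∣ (≮⇒≥ a≮∣Q∣)) ⟩
      ∣ K ∣ + a + t * a      ≡⟨ +-assoc ∣ K ∣ a (t * a) ⟩
      ∣ K ∣ + (a + t * a)    ∎
  ...   | x , x∉K∪Q , large = x , x∉K∪Q ∘ x∈p∪q⁺ ∘ inj₁ , λ where
    (Any.here refl) x∈Q → contradiction (x∈p∪q⁺ (inj₂ x∈Q)) x∉K∪Q
    (Any.there Q′∈Qs) → large Q′∈Qs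
  uncovered {t = suc t} a (Q ∷ Qs) K bound | yes a<∣Q∣
    with uncovered a Qs K (≤-<-trans (+-monoʳ-≤ ∣ K ∣ (m≤n+m (t * a) a)) bound)
  ... | x , x∉K , large = x , x∉K , λ where
    (Any.here refl) _ → a<∣Q∣
    (Any.there Q′∈Qs) → large Q′∈Qs

  -- Deficits and greedy saturation of queries.

  deficit : (Subset n → ℕ) → Vec (Subset n) t → Subset n → ℕ
  deficit need Qs K = sum (map (λ Q → need Q ∸ ∣ Q ∩ K ∣) Qs)

  deficit-≤ : ∀ a (Qs : Vec (Subset n) t) K → deficit (const a) Qs K ≤ t * a
  deficit-≤ a [] K = z≤n
  deficit-≤ a (Q ∷ Qs) K = +-mono-≤ (m∸n≤m a ∣ Q ∩ K ∣) (deficit-≤ a Qs K)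

  ∣Q∩K∣≤∣Q∩K∪[x]∣ : ∀ {x} (Q K : Subset n) → x ∉ K → ∣ Q ∩ K ∣ ≤ ∣ Q ∩ (K ∪[ x ]) ∣
  ∣Q∩K∣≤∣Q∩K∪[x]∣ {x = x} Q K x∉K with x ∈? Q
  ... | yes x∈Q = ≤-trans (n≤1+n _) (≤-reflexive (sym (∣Q∩K∪[x]∣ x∈Q x∉K)))
  ... | no x∉Q = ≤-reflexive (cong ∣_∣ (sym (Q∩K∪[x]≡Q∩K K x∉Q)))

  deficit-mono : ∀ need {x} (Qs : Vec (Subset n) t) K → x ∉ K →
                 deficit need Qs (K ∪[ x ]) ≤ deficit need Qs K
  deficit-mono need [] K x∉K = z≤n
  deficit-mono need (Q ∷ Qs) K x∉K =
    +-mono-≤ (∸-monoʳ-≤ (need Q) (∣Q∩K∣≤∣Q∩K∪[x]∣ Q K x∉K)) (deficit-mono need Qs K x∉K)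

  deficit-strict : ∀ need {x} (Qs : Vec (Subset n) t) K → x ∉ K →
                   ∀ {Q} → Q ∈ᵥ Qs → x ∈ Q → ∣ Q ∩ K ∣ < need Q →
                   deficit need Qs (K ∪[ x ]) < deficit need Qs K
  deficit-strict need (Q ∷ Qs) K x∉K (Any.here refl) x∈Q short =
    +-mono-<-≤ (∸-monoʳ-< (≤-reflexive (sym (∣Q∩K∪[x]∣ x∈Q x∉K)))
                          (≤-trans (≤-reflexive (∣Q∩K∪[x]∣ x∈Q x∉K)) short))
               (deficit-mono need Qs K x∉K)
  deficit-strict need (Q ∷ Qs) K x∉K (Any.there Q′∈Qs) x∈Q short =
    +-mono-≤-< (∸-monoʳ-≤ (need Q) (∣Q∩K∣≤∣Q∩K∪[x]∣ Q K x∉K))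
               (deficit-strict need Qs K x∉K Q′∈Qs x∈Q short)

  -- Elements are added only from V, and only while one of them lowers the deficit by at least
  -- suc e, the parameter d of the header.
  greedy : ∀ need (Qs : Vec (Subset n) t) (V : Subset n) e K →
           ∃[ K′ ] (∣ K′ ∣ * suc e ≤ ∣ K ∣ * suc e + deficit need Qs K ×
                    (∀ {y} → y ∉ V → y ∉ K → y ∉ K′) ×
                    (∀ {y} → y ∈ V → y ∉ K′ → deficit need Qs K′ ≤ deficit need Qs (K′ ∪[ y ]) + e))
  greedy {n} need Qs V e K = go K (<-wellFounded _)
    where
    Φ = deficit need Qs
    go : ∀ K → Acc _<_ (Φ K) →
         ∃[ K′ ] (∣ K′ ∣ * suc e ≤ ∣ K ∣ * suc e + Φ K ×
                  (∀ {y} → y ∉ V → y ∉ K → y ∉ K′) ×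
                  (∀ {y} → y ∈ V → y ∉ K′ → Φ K′ ≤ Φ (K′ ∪[ y ]) + e))
    go K (acc rec) with any? (λ y → y ∈? V ×-dec ¬? (y ∈? K) ×-dec (Φ (K ∪[ y ]) + e <? Φ K))
    ... | no stuck = K , m≤m+n _ _ , (λ _ y∉K → y∉K) ,
          λ y∈V y∉K → ≮⇒≥ λ drop → stuck (_ , y∈V , y∉K , drop)
    ... | yes (y , y∈V , y∉K , drop) with go (K ∪[ y ]) (rec (≤-<-trans (m≤m+n _ e) drop))
    ...   | K′ , size , outsideV , thin = K′ , ≤-trans size cost , keep , thin
      where
      open ≤-Reasoning
      keep : ∀ {z} → z ∉ V → z ∉ K → z ∉ K′
      keep z∉V z∉K = outsideV z∉V λ z∈ →
        [ (λ { refl → z∉V y∈V }) , z∉K ]′ (∈-∪[]⁻ K z∈)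
      rearrange : ∀ a b c → suc a * suc b + c ≡ a * suc b + suc (c + b)
      rearrange = solve-∀
      -- The sum of `suc e` per element and the deficit is a potential that never increases: the
      -- drop caused by `y` pays for `y`.
      cost : ∣ K ∪[ y ] ∣ * suc e + Φ (K ∪[ y ]) ≤ ∣ K ∣ * suc e + Φ K
      cost = begin
        ∣ K ∪[ y ] ∣ * suc e + Φ (K ∪[ y ])    ≡⟨ cong (λ s → s * suc e + Φ (K ∪[ y ])) (∣K∪[x]∣ y∉K) ⟩
        suc ∣ K ∣ * suc e + Φ (K ∪[ y ])       ≡⟨ rearrange ∣ K ∣ e _ ⟩
        ∣ K ∣ * suc e + suc (Φ (K ∪[ y ]) + e) ≤⟨ +-monoʳ-≤ (∣ K ∣ * suc e) drop ⟩
        ∣ K ∣ * suc e + Φ K                    ∎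

  greedy-∅ : ∀ a (Qs : Vec (Subset n) t) e →
             ∃[ K ] (∣ K ∣ * suc e ≤ t * a ×
                     (∀ {y} → y ∉ K → deficit (const a) Qs K ≤ deficit (const a) Qs (K ∪[ y ]) + e))
  greedy-∅ {n} a Qs e with greedy (const a) Qs full e ∅
  ... | K , size , _ , thin = K , ≤-trans
    (subst (λ s → ∣ K ∣ * suc e ≤ s * suc e + deficit (const a) Qs ∅) (∣⊥∣≡0 n) size)
    (deficit-≤ a Qs ∅) , thin ∈⊤

  -- The target of the second greedy phase: only queries through `x` have to be saturated, and with
  -- target 0 every other query contributes nothing to the deficit.
  needAt : ℕ → Fin n → Subset n → ℕ
  needAt a x Q = if does (x ∈? Q) then a else 0

  needAt-∈ : ∀ {a x} {Q : Subset n} → x ∈ Q → needAt a x Q ≡ a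
  needAt-∈ {a = a} {x} {Q} x∈Q = cong (if_then a else 0) (dec-true (x ∈? Q) x∈Q)

  -- Adding x lowers the deficit by one for each unsaturated query through x, and each of these
  -- lacks at most a elements.
  deficit-needAt : ∀ a {x} (Qs : Vec (Subset n) t) K → x ∉ K →
    deficit (needAt a x) Qs K + a * deficit (const a) Qs (K ∪[ x ]) ≤ a * deficit (const a) Qs K
  deficit-needAt a [] K x∉K = ≤-refl
  deficit-needAt a {x} (Q ∷ Qs) K x∉K = begin
    (p + deficit (needAt a x) Qs K) + a * (q + deficit (const a) Qs (K ∪[ x ]))
      ≡⟨ rearrange a p _ q _ ⟩
    (p + a * q) + (deficit (needAt a x) Qs K + a * deficit (const a) Qs (K ∪[ x ]))
      ≤⟨ +-mono-≤ single (deficit-needAt a Qs K x∉K) ⟩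
    a * (a ∸ ∣ Q ∩ K ∣) + a * deficit (const a) Qs K
      ≡⟨ *-distribˡ-+ a _ _ ⟨
    a * (a ∸ ∣ Q ∩ K ∣ + deficit (const a) Qs K) ∎
    where
    open ≤-Reasoning
    p = needAt a x Q ∸ ∣ Q ∩ K ∣
    q = a ∸ ∣ Q ∩ (K ∪[ x ]) ∣
    rearrange : ∀ a p r q s → (p + r) + a * (q + s) ≡ (p + a * q) + (r + a * s)
    rearrange = solve-∀
    unit-drop : ∀ r → r ≤ a → r + a * pred r ≤ a * r
    unit-drop zero    _   = ≤-refl
    unit-drop (suc r) r≤a = ≤-trans (+-monoˡ-≤ (a * r) r≤a) (≤-reflexive (sym (*-suc a r)))
    single : p + a * q ≤ a * (a ∸ ∣ Q ∩ K ∣)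
    single with x ∈? Q
    ... | yes x∈Q rewrite ∣Q∩K∪[x]∣ x∈Q x∉K | sym (pred[m∸n]≡m∸[1+n] a ∣ Q ∩ K ∣) =
      unit-drop (a ∸ ∣ Q ∩ K ∣) (m∸n≤m a ∣ Q ∩ K ∣)
    ... | no x∉Q rewrite Q∩K∪[x]≡Q∩K K x∉Q | 0∸n≡0 ∣ Q ∩ K ∣ = ≤-refl

  -- Indistinguishable sets and the bound for capped feedback.

  map-cong-∈ : ∀ {A B : Set} {f g : A → B} (xs : Vec A t) →
               (∀ {x} → x ∈ᵥ xs → f x ≡ g x) → map f xs ≡ map g xs
  map-cong-∈ [] eq = refl
  map-cong-∈ (x ∷ xs) eq = cong₂ _∷_ (eq (Any.here refl)) (map-cong-∈ xs (eq ∘ Any.there))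

  -- A query avoiding `x` has the same intersection with both sets. A query through `x` meets both
  -- in more than `α` elements, so it returns the capped value `v` twice.
  capped-indistinguishable :
    ∀ {α} {A : Set} {F : Feedback n A} → CappedAt α F → (Qs : Vec (Subset n) t) → ∀ {x K} → x ∉ K →
    (∀ {Q} → Q ∈ᵥ Qs → x ∈ Q → suc α ≤ ∣ Q ∩ K ∣) →
    feedbackVector F Qs K ≡ feedbackVector F Qs (K ∪[ x ])
  capped-indistinguishable {α = α} {F = F} (v , capped) Qs {x} {K} x∉K saturated = map-cong-∈ Qs same
    where
    same : ∀ {Q} → Q ∈ᵥ Qs → F (Q ∩ K) ≡ F (Q ∩ (K ∪[ x ]))
    same {Q} Q∈Qs with x ∈? Q
    ... | no x∉Q = cong F (sym (Q∩K∪[x]≡Q∩K K x∉Q))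
    ... | yes x∈Q = trans (capped _ (saturated Q∈Qs x∈Q))
                          (sym (capped _ (≤-trans (saturated Q∈Qs x∈Q) (∣Q∩K∣≤∣Q∩K∪[x]∣ Q K x∉K))))

  -- An unsaturated large query can be filled further without using `x`. Otherwise `Q` would lie in
  -- the union of the singleton of `x` and `Q ∩ K`, which has at most `a` elements; the strict
  -- `a < ∣ Q ∣` makes room for `x`.
  ∃∈∖ : ∀ {x a} (Q K : Subset n) → x ∉ K → a < ∣ Q ∣ → ∣ Q ∩ K ∣ < a → ∃[ y ] (y ∈ Q × y ≢ x × y ∉ K)
  ∃∈∖ {x = x} {a} Q K x∉K a<∣Q∣ short
    with any? (λ y → y ∈? Q ×-dec ¬? (y ≟ᶠ x) ×-dec ¬? (y ∈? K))
  ... | yes found = found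
  ... | no none = contradiction (begin-strict
    a                      <⟨ a<∣Q∣ ⟩
    ∣ Q ∣                  ≤⟨ p⊆q⇒∣p∣≤∣q∣ Q⊆ ⟩
    ∣ ⁅ x ⁆ ∪ (Q ∩ K) ∣    ≤⟨ ∣p∪q∣≤∣p∣+∣q∣ ⁅ x ⁆ (Q ∩ K) ⟩
    ∣ ⁅ x ⁆ ∣ + ∣ Q ∩ K ∣  ≡⟨ cong (_+ ∣ Q ∩ K ∣) (∣⁅x⁆∣≡1 x) ⟩
    suc ∣ Q ∩ K ∣          ≤⟨ short ⟩
    a                      ∎) (<-irrefl refl)
    where
    open ≤-Reasoning
    Q⊆ : ∀ {y} → y ∈ Q → y ∈ ⁅ x ⁆ ∪ (Q ∩ K)
    Q⊆ {y} y∈Q with y ≟ᶠ x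
    ... | yes refl = x∈p∪q⁺ (inj₁ (x∈⁅x⁆ x))
    ... | no y≢x = x∈p∪q⁺ {p = ⁅ x ⁆} (inj₂ (x∈p∩q⁺
      (y∈Q , decidable-stable (y ∈? K) λ y∉K → none (y , y∈Q , y≢x , y∉K))))

  greedy-bound :
    ∀ {k α} {A : Set} {F : Feedback n A} → CappedAt α F → (Qs : Vec (Subset n) t) →
    SolvesGroupTesting k F Qs → ∀ e →
    let a = suc α in n ≤ 2 * (t * a) ⊎ k * suc e ≤ t * a + e * a * suc e
  greedy-bound {n} {t} {k} {α} capped Qs solves e
    with greedy-∅ (suc α) Qs e
  ... | K , size , thin with ∣ K ∣ + t * suc α <? n
  -- Since `suc e` is at least 1, `size` bounds ∣ K ∣ by `t * a`, so the two summands together give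
  -- `2 * (t * a)`.
  ...   | no cover = inj₁ (begin
      n                 ≤⟨ ≮⇒≥ cover ⟩
      ∣ K ∣ + t * a     ≤⟨ +-monoˡ-≤ (t * a) (≤-trans (m≤m*n ∣ K ∣ (suc e)) size) ⟩
      t * a + t * a     ≡⟨ cong (t * a +_) (+-identityʳ (t * a)) ⟨
      2 * (t * a)       ∎)
    where
    open ≤-Reasoning
    a = suc α
  ...   | yes bound with uncovered (suc α) Qs K bound
  -- The second phase continues from `K`. It draws from the complement of `x`, which keeps `x`
  -- outside, and has slack 0: it stops only when no other element helps at all.
  ...     | x , x∉K , large with greedy (needAt (suc α) x) Qs (∁ ⁅ x ⁆) 0 K
  ...       | K′ , size₂ , outside-K′ , thin₂ = inj₂ (begin
      k * suc e                                ≤⟨ *-monoˡ-≤ (suc e) (≤-trans k≤∣K′∣ ∣K′∣≤) ⟩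
      (∣ K ∣ + e * a) * suc e                  ≡⟨ *-distribʳ-+ (suc e) ∣ K ∣ (e * a) ⟩
      ∣ K ∣ * suc e + e * a * suc e            ≤⟨ +-monoˡ-≤ (e * a * suc e) size ⟩
      t * a + e * a * suc e                    ∎)
    where
    open ≤-Reasoning
    a = suc α
    x∉K′ : x ∉ K′
    x∉K′ = outside-K′ (x∈p⇒x∉∁p (x∈⁅x⁆ x)) x∉K
    -- The first phase stopped, so adding `x` lowers the constant-target deficit by at most `e`;
    -- `deficit-needAt` converts this into at most `e * a` missing elements. Cancelling `a * D′`
    -- avoids truncated subtraction.
    deficit≤ : deficit (needAt a x) Qs K ≤ e * a
    deficit≤ = +-cancelʳ-≤ (a * D′) _ _ (begin
      deficit (needAt a x) Qs K + a * D′  ≤⟨ deficit-needAt a Qs K x∉K ⟩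
      a * deficit (const a) Qs K          ≤⟨ *-monoʳ-≤ a (thin x∉K) ⟩
      a * (D′ + e)                        ≡⟨ rearrange a D′ e ⟩
      e * a + a * D′                      ∎)
      where
      D′ = deficit (const a) Qs (K ∪[ x ])
      rearrange : ∀ a d e → a * (d + e) ≡ e * a + a * d
      rearrange = solve-∀
    ∣K′∣≤ : ∣ K′ ∣ ≤ ∣ K ∣ + e * a
    ∣K′∣≤ = begin
      ∣ K′ ∣                                   ≡⟨ *-identityʳ ∣ K′ ∣ ⟨
      ∣ K′ ∣ * 1                               ≤⟨ size₂ ⟩
      ∣ K ∣ * 1 + deficit (needAt a x) Qs K    ≤⟨ +-mono-≤ (≤-reflexive (*-identityʳ ∣ K ∣)) deficit≤ ⟩
      ∣ K ∣ + e * a                            ∎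
    -- Otherwise `∃∈∖` supplies an element other than `x` that strictly lowers the deficit, against
    -- `thin₂` with its slack 0.
    saturated : ∀ {Q} → Q ∈ᵥ Qs → x ∈ Q → suc α ≤ ∣ Q ∩ K′ ∣
    saturated {Q} Q∈Qs x∈Q = ≮⇒≥ λ short →
      let y , y∈Q , y≢x , y∉K′ = ∃∈∖ Q K′ x∉K′ (large Q∈Qs x∈Q) short in
      <⇒≱ (deficit-strict (needAt a x) Qs K′ y∉K′ Q∈Qs y∈Q
            (subst (∣ Q ∩ K′ ∣ <_) (sym (needAt-∈ x∈Q)) short))
          (≤-trans (thin₂ (x∉p⇒x∈∁p (x≢y⇒x∉⁅y⁆ y≢x)) y∉K′) (≤-reflexive (+-identityʳ _)))
    -- If ∣ K′ ∣ were strictly below `k`, there would be room for `x`, and two distinct admissible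
    -- sets would receive equal feedback.
    k≤∣K′∣ : k ≤ ∣ K′ ∣
    k≤∣K′∣ = ≮⇒≥ λ ∣K′∣<k → solves K′ (K′ ∪[ x ]) (<⇒≤ ∣K′∣<k)
      (≤-trans (≤-reflexive (∣K∪[x]∣ x∉K′)) ∣K′∣<k)
      (λ eq → x∉K′ (subst (x ∈_) (sym eq) (x∈K∪[x] x K′)))
      (capped-indistinguishable capped Qs x∉K′ saturated)

  capped-bound :
    ∀ {k α} .{{_ : NonZero α}} {A : Set} {F : Feedback n A} → CappedAt α F →
    (Qs : Vec (Subset n) t) → SolvesGroupTesting k F Qs →
    n ≤ 16 * t * α ⊎ k * k ≤ 16 * t * (α * α)
  capped-bound {n} {t} {k} {α} capped Qs solves = [ inj₁ ∘ linear , inj₂ ∘ square ]′ (greedy-bound capped Qs solves e)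
    where
    open ≤-Reasoning
    a = suc α
    -- The largest `e` with `e * (2 * a)` at most `k`: the term `e * a * suc e` is then at most half
    -- of `k * suc e` and can be absorbed, while `suc e * (2 * a)` still reaches `k`.
    e = k / (2 * a)
    a≤2α : a ≤ 2 * α
    a≤2α = +-mono-≤ (>-nonZero⁻¹ α) (m≤m+n α 0)
    linear : n ≤ 2 * (t * a) → n ≤ 16 * t * α
    linear bound = begin
      n                     ≤⟨ bound ⟩
      2 * (t * a)           ≤⟨ *-monoʳ-≤ 2 (*-monoʳ-≤ t a≤2α) ⟩
      2 * (t * (2 * α))     ≡⟨ rearrange t α ⟩
      -- The factor 4 is relaxed to 16 so that both alternatives share one constant.
      4 * (t * α)           ≤⟨ *-monoˡ-≤ (t * α) (m≤m+n 4 12) ⟩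
      16 * (t * α)          ≡⟨ *-assoc 16 t α ⟨
      16 * t * α            ∎
      where
      rearrange : ∀ t α → 2 * (t * (2 * α)) ≡ 4 * (t * α)
      rearrange = solve-∀
    square : k * suc e ≤ t * a + e * a * suc e → k * k ≤ 16 * t * (α * α)
    square bound = begin
      k * k                      ≤⟨ *-monoʳ-≤ k k≤ ⟩
      k * (suc e * (2 * a))      ≡⟨ *-assoc k (suc e) (2 * a) ⟨
      k * suc e * (2 * a)        ≤⟨ *-monoˡ-≤ (2 * a) half ⟩
      2 * (t * a) * (2 * a)      ≤⟨ *-mono-≤ (*-monoʳ-≤ 2 (*-monoʳ-≤ t a≤2α)) (*-monoʳ-≤ 2 a≤2α) ⟩
      -- Of the four factors 2, one comes from `half`, one from `k≤`, and two from replacing each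
      -- `a` by `2 * α`.
      2 * (t * (2 * α)) * (2 * (2 * α))    ≡⟨ rearrange₁ t α ⟩
      16 * (t * (α * α))         ≡⟨ *-assoc 16 t (α * α) ⟨
      16 * t * (α * α)           ∎
      where
      rearrange₁ : ∀ t α → 2 * (t * (2 * α)) * (2 * (2 * α)) ≡ 16 * (t * (α * α))
      rearrange₁ = solve-∀
      rearrange₂ : ∀ t a e d → 2 * (t * a + e * a * d) ≡ 2 * (t * a) + e * (2 * a) * d
      rearrange₂ = solve-∀
      double : ∀ m → m + m ≡ 2 * m
      double = solve-∀
      k≤ : k ≤ suc e * (2 * a)
      k≤ = begin
        k                            ≡⟨ m≡m%n+[m/n]*n k (2 * a) ⟩
        k % (2 * a) + e * (2 * a)    ≤⟨ +-monoˡ-≤ (e * (2 * a)) (<⇒≤ (m%n<n k (2 * a))) ⟩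
        2 * a + e * (2 * a)          ∎
      half : k * suc e ≤ 2 * (t * a)
      half = +-cancelʳ-≤ (k * suc e) _ _ (begin
        k * suc e + k * suc e                  ≡⟨ double (k * suc e) ⟩
        2 * (k * suc e)                        ≤⟨ *-monoʳ-≤ 2 bound ⟩
        2 * (t * a + e * a * suc e)            ≡⟨ rearrange₂ t a e (suc e) ⟩
        2 * (t * a) + e * (2 * a) * suc e      ≤⟨ +-monoʳ-≤ (2 * (t * a)) (*-monoˡ-≤ (suc e) (m/n*n≤m k (2 * a))) ⟩
        2 * (t * a) + k * suc e                ∎)

  -- Counting feedback vectors.

  rank : Subset n → Fin n → ℕ
  rank (_ ∷ p)       zero    = 0
  rank (inside ∷ p)  (suc x) = suc (rank p x)
  rank (outside ∷ p) (suc x) = rank p x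

  rank-< : ∀ {p : Subset n} {x} → x ∈ p → rank p x < ∣ p ∣
  rank-< here = z<s
  rank-< {p = inside ∷ p}  (there x∈p) = s<s (rank-< x∈p)
  rank-< {p = outside ∷ p} (there x∈p) = rank-< x∈p

  rank-injective : ∀ {p : Subset n} {x y} → x ∈ p → y ∈ p → rank p x ≡ rank p y → x ≡ y
  rank-injective here here _ = refl
  rank-injective {p = inside ∷ p} (there x∈p) (there y∈p) eq =
    cong suc (rank-injective x∈p y∈p (suc-injective eq))
  rank-injective {p = outside ∷ p} (there x∈p) (there y∈p) eq =
    cong suc (rank-injective x∈p y∈p eq)

  image : ∀ {k} → (Fin k → Fin n) → Subset n
  image {k = zero}  f = ∅
  image {k = suc k} f = ⁅ f zero ⁆ ∪ image (f ∘ suc)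

  ∣image∣≤ : ∀ {k} (f : Fin k → Fin n) → ∣ image f ∣ ≤ k
  ∣image∣≤ {n} {zero}  f = ≤-reflexive (∣⊥∣≡0 n)
  ∣image∣≤ {n} {suc k} f = ≤-trans (∣p∪q∣≤∣p∣+∣q∣ ⁅ f zero ⁆ _)
    (+-mono-≤ (≤-reflexive (∣⁅x⁆∣≡1 (f zero))) (∣image∣≤ (f ∘ suc)))

  ∈-image : ∀ {k} (f : Fin k → Fin n) i → f i ∈ image f
  ∈-image f zero    = x∈p∪q⁺ (inj₁ (x∈⁅x⁆ (f zero)))
  ∈-image f (suc i) = x∈p∪q⁺ {p = ⁅ f zero ⁆} (inj₂ (∈-image (f ∘ suc) i))

  -- Codes of functions depend only on their values, so pointwise agreement suffices when decoded
  -- functions are compared in `encode-injective`.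
  funToFin-cong : ∀ {m n} {f g : Fin m → Fin n} → f ≗ g → funToFin f ≡ funToFin g
  funToFin-cong {zero}  eq = refl
  funToFin-cong {suc m} eq = cong₂ combine (eq zero) (funToFin-cong (eq ∘ suc))

  funToFin-injective : ∀ {m n} {f g : Fin m → Fin n} → funToFin f ≡ funToFin g → f ≗ g
  funToFin-injective {f = f} {g} eq i = begin
    f i                        ≡⟨ finToFun-funToFin f i ⟨
    finToFun (funToFin f) i    ≡⟨ cong (λ c → finToFun c i) eq ⟩
    finToFun (funToFin g) i    ≡⟨ finToFun-funToFin g i ⟩
    g i                        ∎
    where open ≡-Reasoning

  lookup-injective : ∀ {A : Set} {xs ys : Vec A t} → lookup xs ≗ lookup ys → xs ≡ ys
  lookup-injective {xs = xs} {ys} eq = begin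
    xs    ≡⟨ tabulate∘lookup xs ⟨
    _     ≡⟨ tabulate-cong eq ⟩
    _     ≡⟨ tabulate∘lookup ys ⟩
    ys    ∎
    where open ≡-Reasoning

  -- Counting functions instead of subsets of size `k` produces the ratio of `n ^ k` to `k ^ k` at
  -- once, without estimating a binomial coefficient. `encode` pairs the `t` answers with the `k`
  -- ranks.
  information-bound : ∀ {k α} (Qs : Vec (Subset n) t) → SolvesGroupTesting k F[ α ] Qs →
                      n ^ k ≤ suc α ^ t * k ^ k
  information-bound {n} {t} {k} {α} Qs solves = injective⇒≤ {f = encode} encode-injective
    where
    feedback : Subset n → Fin t → ℕ
    feedback K j = F[ α ] (lookup Qs j ∩ K)
    feedback< : ∀ K j → feedback K j < suc α
    feedback< K j = s≤s (m⊓n≤n _ α)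
    ranks< : ∀ (f : Fin k → Fin n) j → rank (image f) (f j) < k
    ranks< f j = <-≤-trans (rank-< (∈-image f j)) (∣image∣≤ f)
    answers : (Fin k → Fin n) → Fin t → Fin (suc α)
    answers f j = fromℕ< (feedback< (image f) j)
    ranks : (Fin k → Fin n) → Fin k → Fin k
    ranks f j = fromℕ< (ranks< f j)
    encode : Fin (n ^ k) → Fin (suc α ^ t * k ^ k)
    encode c = combine (funToFin (answers (finToFun c))) (funToFin (ranks (finToFun c)))

    image-determined : ∀ f g → answers f ≗ answers g → image f ≡ image g
    -- Solvability only says that distinct sets have distinct vectors; decidable equality of subsets
    -- turns this into injectivity.
    image-determined f g eq = decidable-stable (≡-dec _≟ᵇ_ (image f) (image g)) λ differ →
      solves (image f) (image g) (∣image∣≤ f) (∣image∣≤ g) differ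
        (lookup-injective λ j → begin
          lookup (feedbackVector F[ α ] Qs (image f)) j  ≡⟨ lookup-map j _ Qs ⟩
          feedback (image f) j                           ≡⟨ fromℕ<-injective _ _ (feedback< (image f) j) (feedback< (image g) j) (eq j) ⟩
          feedback (image g) j                           ≡⟨ lookup-map j _ Qs ⟨
          lookup (feedbackVector F[ α ] Qs (image g)) j  ∎)
      where open ≡-Reasoning

    determined : ∀ f g → answers f ≗ answers g → ranks f ≗ ranks g → f ≗ g
    determined f g sameAnswers sameRanks j = rank-injective {p = image f} (∈-image f j)
      (subst (g j ∈_) (sym sameImage) (∈-image g j)) (begin
        rank (image f) (f j)  ≡⟨ fromℕ<-injective _ _ (ranks< f j) (ranks< g j) (sameRanks j) ⟩
        rank (image g) (g j)  ≡⟨ cong (λ p → rank p (g j)) sameImage ⟨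
        rank (image f) (g j)  ∎)
      where
      open ≡-Reasoning
      sameImage = image-determined f g sameAnswers

    encode-injective : ∀ {c d} → encode c ≡ encode d → c ≡ d
    encode-injective {c} {d} eq with combine-injective (funToFin (answers (finToFun c))) _ _ _ eq
    ... | eqAnswers , eqRanks = begin
      c                                ≡⟨ funToFin-finToFin {k} c ⟨
      funToFin {k} {n} (finToFun c)    ≡⟨ funToFin-cong (determined (finToFun c) (finToFun d) (funToFin-injective eqAnswers) (funToFin-injective eqRanks)) ⟩
      funToFin {k} {n} (finToFun d)    ≡⟨ funToFin-finToFin {k} d ⟩
      d                                ∎
      where open ≡-Reasoning

  ^-distribʳ-* : ∀ e x y → (x * y) ^ e ≡ x ^ e * y ^ e
  ^-distribʳ-* zero    x y = refl
  ^-distribʳ-* (suc e) x y =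
    trans (cong (x * y *_) (^-distribʳ-* e x y)) ([m*n]*[o*p]≡[m*o]*[n*p] x y _ _)

  -- The hypothesis says that p / d is at most log (n / k) / log (α ⊔ 2), with denominators cleared.
  -- Its `k`-th power and the `d`-th power of `information-bound` meet at `n ^ (k * d)`; cancelling
  -- `k ^ (k * d)` leaves powers of `β` to compare. The factor 2 comes from `1+α≤β²`.
  log-bound : ∀ {k α p d} .{{_ : NonZero k}} (Qs : Vec (Subset n) t) → SolvesGroupTesting k F[ α ] Qs →
              (α ⊔ 2) ^ p * k ^ d ≤ n ^ d → k * p ≤ 2 * (t * d)
  log-bound {n} {t} {k} {α} {p} {d} Qs solves hyp = ≮⇒≥ λ lt →
    <⇒≱ (^-monoʳ-< β (m≤n⊔m α 2) lt) (*-cancelʳ-≤ _ _ (k ^ (k * d)) {{m^n≢0 k (k * d)}} (begin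
      β ^ (k * p) * k ^ (k * d)            ≡⟨ cong₂ _*_ (pow β p) (pow k d) ⟩
      (β ^ p) ^ k * (k ^ d) ^ k            ≡⟨ ^-distribʳ-* k (β ^ p) (k ^ d) ⟨
      (β ^ p * k ^ d) ^ k                  ≤⟨ ^-monoˡ-≤ k hyp ⟩
      (n ^ d) ^ k                          ≡⟨ pow n d ⟨
      n ^ (k * d)                          ≡⟨ ^-*-assoc n k d ⟨
      (n ^ k) ^ d                          ≤⟨ ^-monoˡ-≤ d (information-bound Qs solves) ⟩
      (suc α ^ t * k ^ k) ^ d              ≤⟨ ^-monoˡ-≤ d (*-monoˡ-≤ (k ^ k) (^-monoˡ-≤ t 1+α≤β²)) ⟩
      ((β ^ 2) ^ t * k ^ k) ^ d            ≡⟨ ^-distribʳ-* d _ _ ⟩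
      ((β ^ 2) ^ t) ^ d * (k ^ k) ^ d      ≡⟨ cong₂ _*_ (trans (^-*-assoc (β ^ 2) t d) (^-*-assoc β 2 (t * d))) (^-*-assoc k k d) ⟩
      β ^ (2 * (t * d)) * k ^ (k * d)      ∎))
    where
    open ≤-Reasoning
    β = α ⊔ 2
    pow : ∀ b e → b ^ (k * e) ≡ (b ^ e) ^ k
    pow b e = trans (cong (b ^_) (*-comm k e)) (sym (^-*-assoc b e k))
    1+α≤β² : suc α ≤ β ^ 2
    1+α≤β² = begin
      1 + α    ≤⟨ +-mono-≤ (≤-trans (n≤1+n 1) (m≤n⊔m α 2)) (m≤m⊔n α 2) ⟩
      β + β    ≡⟨ cong (β +_) (+-identityʳ β) ⟨
      2 * β    ≤⟨ *-monoˡ-≤ β (m≤n⊔m α 2) ⟩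
      β * β    ≡⟨ cong (β *_) (*-identityʳ β) ⟨
      β ^ 2    ∎

open Combinatorics using (capped-bound; log-bound)
open import Defs
open import Data.Fin.Subset using (Subset)
open import Data.Integer using (+_; -[1+_])
import Data.Integer as ℤ
import Data.Integer.Properties as ℤₚ
import Data.Nat as ℕ
import Data.Nat.Properties as ℕₚ
open import Data.Nat using (ℕ; NonZero; suc; _≤_)
open import Data.Product using (∃-syntax; _×_; _,_)
open import Data.Rational using (ℚ; 0ℚ; mkℚ; _/_; _*_; _+_; toℚᵘ) renaming (_<_ to _<ℚ_; _≤_ to _≤ᵣ_)
open import Data.Rational.Properties
import Data.Rational.Unnormalised as ℚᵘ
import Data.Rational.Unnormalised.Properties as ℚᵘₚ
open import Data.Sum using (_⊎_; inj₁; inj₂)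
open import Data.Vec using (Vec)
open import Relation.Binary.PropositionalEquality
open import Algebra.Bundles using (CommutativeRing)
open import Algebra.Properties.CommutativeSemiring.Exp
  (CommutativeRing.commutativeSemiring +-*-commutativeRing) using (^-distrib-*)

-- Transfer between natural and rational inequalities.

ι : ℕ → ℚ
ι m = + m / 1

-- Reduced fractions do not compute for a variable `m`. Up to unnormalised equivalence the numerator
-- is `m` itself; the 0 encodes denominator 1.
ι-≃ : ∀ m → toℚᵘ (ι m) ℚᵘ.≃ ℚᵘ.mkℚᵘ (+ m) 0
ι-≃ m = toℚᵘ-fromℚᵘ (ℚᵘ.mkℚᵘ (+ m) 0)

ι-mono : ∀ {a b} → a ≤ b → ι a ≤ᵣ ι b
ι-mono {a} {b} a≤b = toℚᵘ-cancel-≤ (begin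
  toℚᵘ (ι a)            ≃⟨ ι-≃ a ⟩
  ℚᵘ.mkℚᵘ (+ a) 0       ≤⟨ ℚᵘ.*≤* (subst₂ ℤ._≤_ (sym (ℤₚ.*-identityʳ (+ a))) (sym (ℤₚ.*-identityʳ (+ b))) (ℤ.+≤+ a≤b)) ⟩
  ℚᵘ.mkℚᵘ (+ b) 0       ≃⟨ ι-≃ b ⟨
  toℚᵘ (ι b)            ∎)
  where open ℚᵘₚ.≤-Reasoning

ι-cancel : ∀ {a b} → ι a ≤ᵣ ι b → a ≤ b
ι-cancel {a} {b} ιa≤ιb with (begin
  ℚᵘ.mkℚᵘ (+ a) 0       ≃⟨ ι-≃ a ⟨
  toℚᵘ (ι a)            ≤⟨ toℚᵘ-mono-≤ ιa≤ιb ⟩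
  toℚᵘ (ι b)            ≃⟨ ι-≃ b ⟩
  ℚᵘ.mkℚᵘ (+ b) 0       ∎)
  where open ℚᵘₚ.≤-Reasoning
... | ℚᵘ.*≤* a*1≤b*1 = ℤₚ.drop‿+≤+ (subst₂ ℤ._≤_ (ℤₚ.*-identityʳ (+ a)) (ℤₚ.*-identityʳ (+ b)) a*1≤b*1)

ι-* : ∀ a b → ι (a ℕ.* b) ≡ ι a * ι b
ι-* a b = toℚᵘ-injective (begin
  toℚᵘ (ι (a ℕ.* b))                      ≈⟨ ι-≃ (a ℕ.* b) ⟩
  ℚᵘ.mkℚᵘ (+ (a ℕ.* b)) 0                 ≈⟨ ℚᵘ.*≡* (cong (ℤ._* + 1) (ℤₚ.pos-* a b)) ⟩
  ℚᵘ.mkℚᵘ (+ a) 0 ℚᵘ.* ℚᵘ.mkℚᵘ (+ b) 0    ≈⟨ ℚᵘₚ.*-cong (ι-≃ a) (ι-≃ b) ⟨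
  toℚᵘ (ι a) ℚᵘ.* toℚᵘ (ι b)              ≈⟨ toℚᵘ-homo-* (ι a) (ι b) ⟨
  toℚᵘ (ι a * ι b)                        ∎)
  where open import Relation.Binary.Reasoning.Setoid ℚᵘₚ.≃-setoid

/-*-cancel : ∀ i d .{{_ : NonZero d}} → (i / d) * ι d ≡ i / 1
/-*-cancel i d@(suc d-1) = toℚᵘ-injective (begin
  toℚᵘ ((i / d) * ι d)                    ≈⟨ toℚᵘ-homo-* (i / d) (ι d) ⟩
  toℚᵘ (i / d) ℚᵘ.* toℚᵘ (ι d)            ≈⟨ ℚᵘₚ.*-cong (toℚᵘ-fromℚᵘ (ℚᵘ.mkℚᵘ i d-1)) (ι-≃ d) ⟩
  ℚᵘ.mkℚᵘ i d-1 ℚᵘ.* ℚᵘ.mkℚᵘ (+ d) 0      ≈⟨ ℚᵘ.*≡* (trans (ℤₚ.*-identityʳ (i ℤ.* + d)) (cong (λ e → i ℤ.* + e) (sym (ℕₚ.*-identityʳ d)))) ⟩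
  ℚᵘ.mkℚᵘ i 0                             ≈⟨ toℚᵘ-fromℚᵘ (ℚᵘ.mkℚᵘ i 0) ⟨
  toℚᵘ (i / 1)                            ∎)
  where open import Relation.Binary.Reasoning.Setoid ℚᵘₚ.≃-setoid

ι-^ : ∀ a e → ι (a ℕ.^ e) ≡ ι a ^ e
ι-^ a ℕ.zero = refl
ι-^ a (suc e) = trans (ι-* a (a ℕ.^ e)) (cong (ι a *_) (ι-^ a e))

-- Multiplying by the positive `ι (d ℕ.^ e)` clears the denominator and leaves an inequality between
-- naturals; `≤-/-^` goes the opposite way.
/-^-≤ : ∀ m d e b .{{_ : NonZero d}} → m ℕ.^ e ≤ b ℕ.* d ℕ.^ e → (+ m / d) ^ e ≤ᵣ ι b
/-^-≤ m d e b bound = *-cancelʳ-≤-pos (ι (d ℕ.^ e)) {{normalize-pos (d ℕ.^ e) 1 {{_}} {{ℕₚ.m^n≢0 d e}}}} (begin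
  (+ m / d) ^ e * ι (d ℕ.^ e)   ≡⟨ cong ((+ m / d) ^ e *_) (ι-^ d e) ⟩
  (+ m / d) ^ e * ι d ^ e       ≡⟨ ^-distrib-* (+ m / d) (ι d) e ⟨
  ((+ m / d) * ι d) ^ e         ≡⟨ cong (_^ e) (/-*-cancel (+ m) d) ⟩
  ι m ^ e                       ≡⟨ ι-^ m e ⟨
  ι (m ℕ.^ e)                   ≤⟨ ι-mono bound ⟩
  ι (b ℕ.* d ℕ.^ e)             ≡⟨ ι-* b (d ℕ.^ e) ⟩
  ι b * ι (d ℕ.^ e)             ∎)
  where open ≤-Reasoning

≤-/-^ : ∀ a m d e .{{_ : NonZero d}} → ι a ≤ᵣ (+ m / d) ^ e → a ℕ.* d ℕ.^ e ≤ m ℕ.^ e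
≤-/-^ a m d e bound = ι-cancel (begin
  ι (a ℕ.* d ℕ.^ e)             ≡⟨ ι-* a (d ℕ.^ e) ⟩
  ι a * ι (d ℕ.^ e)             ≤⟨ *-monoʳ-≤-nonNeg (ι (d ℕ.^ e)) {{normalize-nonNeg (d ℕ.^ e) 1}} bound ⟩
  (+ m / d) ^ e * ι (d ℕ.^ e)   ≡⟨ cong ((+ m / d) ^ e *_) (ι-^ d e) ⟩
  (+ m / d) ^ e * ι d ^ e       ≡⟨ ^-distrib-* (+ m / d) (ι d) e ⟨
  ((+ m / d) * ι d) ^ e         ≡⟨ cong (_^ e) (/-*-cancel (+ m) d) ⟩
  ι m ^ e                       ≡⟨ ι-^ m e ⟨
  ι (m ℕ.^ e)                   ∎)
  where open ≤-Reasoning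

-- The two terms of the bound and the final constants.

minTerm-≤ : ∀ n k α b .{{_ : NonZero α}} → n ≤ b ℕ.* α ⊎ k ℕ.* k ≤ b ℕ.* (α ℕ.* α) →
            minTerm n k α ≤ᵣ ι b
minTerm-≤ n k α b (inj₁ n≤bα) = ≤-trans (p⊓q≤q ((+ k / α) ^ 2) (+ n / α))
  -- The fraction n / α is treated as a first power, so that `/-^-≤` serves both entries of the
  -- minimum.
  (subst (_≤ᵣ ι b) (*-identityʳ (+ n / α)) (/-^-≤ n α 1 b
    (subst₂ (λ x y → x ≤ b ℕ.* y) (sym (ℕₚ.*-identityʳ n)) (sym (ℕₚ.*-identityʳ α)) n≤bα)))
minTerm-≤ n k α b (inj₂ k²≤bα²) = ≤-trans (p⊓q≤p ((+ k / α) ^ 2) (+ n / α)) (/-^-≤ k α 2 b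
  (subst₂ (λ x y → k ℕ.* x ≤ b ℕ.* (α ℕ.* y)) (sym (ℕₚ.*-identityʳ k)) (sym (ℕₚ.*-identityʳ α)) k²≤bα²))

-- Every member of the cut is at most `ι k * q` for some rational `q` in the cut of the logarithm. A
-- negative `q` makes this product at most 0; for q = p / d with p ≥ 0, multiplying by `d` reduces
-- the claim to `log-bound`.
logTerm-≤ : ∀ {n k α t} .{{_ : NonZero k}} (Qs : Vec (Subset n) t) →
            SolvesGroupTesting k F[ α ] Qs → logTerm n k α ≤ℚ ι (2 ℕ.* t)
logTerm-≤ {k = k} {t = t} Qs solves r (q@(mkℚ -[1+ _ ] _ _) , _ , r≤) = begin
  r             ≤⟨ r≤ ⟩
  ι k * q       ≤⟨ *-monoˡ-≤-nonNeg (ι k) {{normalize-nonNeg k 1}} (nonPositive⁻¹ q) ⟩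
  ι k * 0ℚ      ≡⟨ *-zeroʳ (ι k) ⟩
  0ℚ            ≤⟨ ι-mono {0} {2 ℕ.* t} ℕ.z≤n ⟩
  ι (2 ℕ.* t)   ∎
  where open ≤-Reasoning
logTerm-≤ {n} {k} {α} {t} Qs solves r (q@(mkℚ (+ p) d-1 _) , βᵖ≤[n/k]ᵈ , r≤) =
  ≤-trans r≤ (*-cancelʳ-≤-pos (ι d) {{normalize-pos d 1}} (begin
    ι k * q * ι d          ≡⟨ *-assoc (ι k) q (ι d) ⟩
    ι k * (q * ι d)        ≡⟨ cong (λ s → ι k * (s * ι d)) (↥p/↧p≡p q) ⟨
    ι k * (+ p / d * ι d)  ≡⟨ cong (ι k *_) (/-*-cancel (+ p) d) ⟩
    ι k * ι p              ≡⟨ ι-* k p ⟨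
    ι (k ℕ.* p)            ≤⟨ ι-mono (log-bound {p = p} {d} Qs solves (≤-/-^ ((α ℕ.⊔ 2) ℕ.^ p) n k d (≤-trans (≤-reflexive (ι-^ (α ℕ.⊔ 2) p)) βᵖ≤[n/k]ᵈ))) ⟩
    ι (2 ℕ.* (t ℕ.* d))    ≡⟨ cong ι (ℕₚ.*-assoc 2 t d) ⟨
    ι (2 ℕ.* t ℕ.* d)      ≡⟨ ι-* (2 ℕ.* t) d ⟩
    ι (2 ℕ.* t) * ι d      ∎))
  where
  open ≤-Reasoning
  d = suc d-1

-- Lets `capped-bound` supply the first summand of part (i).
F-capped : ∀ {n} α → CappedAt α (F[_] {n} α)
F-capped α = α , λ _ α<∣X∣ → ℕₚ.m≥n⇒m⊓n≡n (ℕₚ.<⇒≤ α<∣X∣)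

theorem2 :
    (∃[ c ] (0ℚ <ℚ c ×
      (∀ (n k α : ℕ) .{{_ : NonZero α}} .{{_ : NonZero k}} → α ≤ k → k ≤ n →
       ∀ (t : ℕ) (Qs : Vec (Subset n) t) →
       SolvesGroupTesting k F[ α ] Qs →
       c ⊛ (↑ minTerm n k α ⊕ logTerm n k α) ≤ℚ (+ t / 1))))
    ×
    (∃[ c ] (0ℚ <ℚ c ×
      (∀ (n k α : ℕ) .{{_ : NonZero α}} .{{_ : NonZero k}} → α ≤ k → k ≤ n →
       ∀ (A : Set) (F : Feedback n A) → CappedAt α F →
       ∀ (t : ℕ) (Qs : Vec (Subset n) t) →
       SolvesGroupTesting k F Qs →
       c * minTerm n k α ≤ᵣ (+ t / 1))))
theorem2 = (c₁ , positive⁻¹ c₁ , part-i) , (c₂ , positive⁻¹ c₂ , part-ii)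
  where
  open ≤-Reasoning
  -- The 16 is the constant of `capped-bound`; 18 adds the 2 of `logTerm-≤`.
  c₁ c₂ : ℚ
  c₁ = + 1 / 18
  c₂ = + 1 / 16
  part-i : ∀ (n k α : ℕ) .{{_ : NonZero α}} .{{_ : NonZero k}} → α ≤ k → k ≤ n →
           ∀ (t : ℕ) (Qs : Vec (Subset n) t) → SolvesGroupTesting k F[ α ] Qs →
           c₁ ⊛ (↑ minTerm n k α ⊕ logTerm n k α) ≤ℚ ι t
  part-i n k α _ _ t Qs solves r (s , (a , b , a≤min , b∈log , s≤a+b) , r≤c₁s) = begin
    r                                    ≤⟨ r≤c₁s ⟩
    c₁ * s                               ≤⟨ *-monoˡ-≤-nonNeg c₁ s≤18t ⟩
    c₁ * (ι 18 * ι t)                    ≡⟨ *-assoc c₁ (ι 18) (ι t) ⟨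
    -- The closed product `c₁ * ι 18` evaluates to 1, so the identity law applies directly.
    c₁ * ι 18 * ι t                      ≡⟨ *-identityˡ (ι t) ⟩
    ι t                                  ∎
    where
    s≤18t : s ≤ᵣ ι 18 * ι t
    s≤18t = begin
      s                             ≤⟨ s≤a+b ⟩
      a + b                         ≤⟨ +-mono-≤ (≤-trans a≤min (minTerm-≤ n k α (16 ℕ.* t) (capped-bound (F-capped α) Qs solves))) (logTerm-≤ Qs solves b b∈log) ⟩
      ι (16 ℕ.* t) + ι (2 ℕ.* t)    ≡⟨ cong₂ _+_ (ι-* 16 t) (ι-* 2 t) ⟩
      ι 16 * ι t + ι 2 * ι t        ≡⟨ *-distribʳ-+ (ι t) (ι 16) (ι 2) ⟨
      ι 18 * ι t                    ∎
  part-ii : ∀ (n k α : ℕ) .{{_ : NonZero α}} .{{_ : NonZero k}} → α ≤ k → k ≤ n →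
            ∀ (A : Set) (F : Feedback n A) → CappedAt α F →
            ∀ (t : ℕ) (Qs : Vec (Subset n) t) → SolvesGroupTesting k F Qs →
            c₂ * minTerm n k α ≤ᵣ ι t
  part-ii n k α _ _ A F capped t Qs solves = begin
    c₂ * minTerm n k α     ≤⟨ *-monoˡ-≤-nonNeg c₂ (minTerm-≤ n k α (16 ℕ.* t) (capped-bound capped Qs solves)) ⟩
    c₂ * ι (16 ℕ.* t)      ≡⟨ cong (c₂ *_) (ι-* 16 t) ⟩
    c₂ * (ι 16 * ι t)      ≡⟨ *-assoc c₂ (ι 16) (ι t) ⟨
    c₂ * ι 16 * ι t        ≡⟨ *-identityˡ (ι t) ⟩
    ι t                    ∎
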